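{- $C_3(82) = 7$.
   Context: For positive integers $m, r$, $C_m(r)$ is the minimum odd positive integer $n$ such that there exist vectors $v_1, \ldots, v_n \in \mathbb{Z}^m$ (not necessarily distinct) with $|v_i| = \sqrt{r}$ (Euclidean norm) for every $i$ and $v_1 + \cdots + v_n = \mathbf{0}$; if no such odd $n$ exists, $C_m(r) = 0$. -}

module Defs where

open import Data.Nat.Base using (ℕ; NonZero; _≤_; parity)
open import Data.Nat.Induction using (<-rec)
open import Data.Nat.Properties using (≤-antisym; ≮⇒≥)
open import Data.Integer.Base using (ℤ; +_; 0ℤ; _+_; _*_)
open import Data.Parity.Base using (1ℙ)
open import Data.Product.Base using (∃; _×_; _,_)
open import Data.Sum.Base using (_⊎_; inj₁; inj₂)
open import Data.Vec.Base using (Vec; foldr′; map; replicate; zipWith)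
open import Data.Vec.Relation.Unary.All using (All)
open import Relation.Binary.PropositionalEquality.Core using (_≡_; refl; sym; trans)
open import Relation.Nullary.Negation using (¬_; contradiction)

Odd : ℕ → Set
Odd n = parity n ≡ 1ℙ

infixl 6 _⊕_

_⊕_ : ∀ {m} → Vec ℤ m → Vec ℤ m → Vec ℤ m
_⊕_ = zipWith _+_

𝟎 : ∀ {m} → Vec ℤ m
𝟎 = replicate _ 0ℤ

vectorSum : ∀ {m n} → Vec (Vec ℤ m) n → Vec ℤ m
vectorSum = foldr′ _⊕_ 𝟎

∥_∥² : ∀ {m} → Vec ℤ m → ℤ
∥ v ∥² = foldr′ _+_ 0ℤ (map (λ x → x * x) v)

-- The condition |v| = √r on the Euclidean norm, squared on both sides so as
-- to stay within ℤ.
HasNorm√ : ∀ {m} → ℕ → Vec ℤ m → Set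
HasNorm√ r v = ∥ v ∥² ≡ + r

ZeroSum : (m r n : ℕ) → Set
ZeroSum m r n = ∃ λ (vs : Vec (Vec ℤ m) n) → All (HasNorm√ r) vs × vectorSum vs ≡ 𝟎

OddZeroSum : (m r n : ℕ) → Set
OddZeroSum m r n = Odd n × ZeroSum m r n

IsMinimum : (ℕ → Set) → ℕ → Set
IsMinimum P n = P n × (∀ k → P k → n ≤ k)

-- C m r ≔ n is the graph of the function (m , r) ↦ C_m(r), that is, the
-- assertion "C_m(r) = n".  A graph is used because the definition by cases
-- asks whether a suitable odd number exists at all; C-functional and C-total
-- show that it has exactly one value (existence being classical).
infix 4 C_,_≔_

C_,_≔_ : (m r : ℕ) .{{_ : NonZero m}} .{{_ : NonZero r}} → ℕ → Set
C m , r ≔ n = IsMinimum (OddZeroSum m r) n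
            ⊎ ((∀ k → ¬ OddZeroSum m r k) × n ≡ 0)

C-functional : ∀ m r .{{_ : NonZero m}} .{{_ : NonZero r}} {n n′} →
               C m , r ≔ n → C m , r ≔ n′ → n ≡ n′
C-functional _ _ (inj₁ (p , min)) (inj₁ (p′ , min′))   = ≤-antisym (min _ p′) (min′ _ p)
C-functional _ _ (inj₁ (p , _))   (inj₂ (none , _))    = contradiction p (none _)
C-functional _ _ (inj₂ (none , _)) (inj₁ (p , _))      = contradiction p (none _)
C-functional _ _ (inj₂ (_ , n≡0)) (inj₂ (_ , n′≡0))    = trans n≡0 (sym n′≡0)

C-total : ∀ m r .{{_ : NonZero m}} .{{_ : NonZero r}} → ¬ ¬ (∃ λ n → C m , r ≔ n)
C-total m r ¬C = ¬C (0 , inj₂ (none , refl))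
  where
  none : ∀ k → ¬ OddZeroSum m r k
  none = <-rec _ λ k smaller p →
    ¬C (k , inj₁ (p , λ j q → ≮⇒≥ λ j<k → smaller j<k q))

{-# OPTIONS --safe #-}

-- If v₁ + ⋯ + vₙ = 𝟎 with all |vᵢ|² = 82, then v₂ + ⋯ + vₙ = −v₁ also has
-- squared norm 82.  There are only 48 integer vectors of squared norm 82, and
-- no multiset of 0, 2 or 4 of them has a sum of squared norm 82, which excludes
-- n = 1, 3, 5.  Counting multisets instead of tuples leaves about 250 000
-- sums for n = 5, few enough to be evaluated.

module Submission where

open import Data.Bool.Base using (Bool; true; not)
open import Data.Bool.ListAction using (all)
open import Data.Bool.Properties using (T-≡)
open import Data.Integer.Base using (ℤ; +_; -[1+_]; 0ℤ; _+_; _*_; -_; ∣_∣)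
open import Data.Integer.Properties as ℤ using (_≟_)
open import Data.List.Base using (List; []; _∷_; _++_; map; upTo; filter; cartesianProductWith)
open import Data.List.Membership.Propositional using (_∈_)
open import Data.List.Membership.Propositional.Properties using (∈-map⁺; ∈-map⁻; ∈-++⁺ˡ; ∈-++⁺ʳ; ∈-++⁻; ∈-upTo⁺; ∈-filter⁺; ∈-cartesianProductWith⁺)
import Data.List.Relation.Unary.All as List-All
open import Data.List.Relation.Unary.All.Properties using (all⁺)
open import Data.List.Relation.Unary.Any using (here; there)
open import Data.Nat.Base as ℕ using (ℕ; zero; suc; nonZero; _≤_; _<_; s≤s)
import Data.Nat.Properties as ℕ
open import Data.Product.Base using (_,_)
open import Data.Sum.Base using (inj₁; [_,_]′)
open import Data.Vec.Base using (Vec; []; _∷_)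
open import Data.Vec.Properties using (zipWith-assoc; zipWith-comm; ∷-injective)
open import Data.Vec.Relation.Unary.All as All using (All; []; _∷_)
open import Function.Bundles using (Equivalence)
open import Relation.Binary.PropositionalEquality using (_≡_; refl; sym; trans; cong; cong₂; subst; module ≡-Reasoning)
open import Relation.Nullary.Decidable using (Dec; isYes; toWitnessFalse)
open import Relation.Nullary.Negation using (¬_; contradiction)
open import Defs

private
  variable
    m n r b : ℕ

⊕-swap : (u v w : Vec ℤ m) → u ⊕ (v ⊕ w) ≡ v ⊕ (u ⊕ w)
⊕-swap u v w = begin
  u ⊕ (v ⊕ w) ≡⟨ zipWith-assoc ℤ.+-assoc u v w ⟨
  u ⊕ v ⊕ w   ≡⟨ cong (_⊕ w) (zipWith-comm ℤ.+-comm u v) ⟩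
  v ⊕ u ⊕ w   ≡⟨ zipWith-assoc ℤ.+-assoc v u w ⟩
  v ⊕ (u ⊕ w) ∎
  where open ≡-Reasoning

x*x≡+∣x∣*∣x∣ : ∀ x → x * x ≡ + (∣ x ∣ ℕ.* ∣ x ∣)
x*x≡+∣x∣*∣x∣ (+ n)    = ℤ.+◃n≡+n (n ℕ.* n)
x*x≡+∣x∣*∣x∣ -[1+ n ] = refl

x+y≡0⇒y*y≡x*x : ∀ x y → x + y ≡ 0ℤ → y * y ≡ x * x
x+y≡0⇒y*y≡x*x x y x+y≡0 = begin
  y * y                   ≡⟨ x*x≡+∣x∣*∣x∣ y ⟩
  + (∣ y ∣ ℕ.* ∣ y ∣)     ≡⟨ cong (λ k → + (k ℕ.* k)) ∣y∣≡∣x∣ ⟩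
  + (∣ x ∣ ℕ.* ∣ x ∣)     ≡⟨ x*x≡+∣x∣*∣x∣ x ⟨
  x * x                   ∎
  where
  open ≡-Reasoning
  x≡-y : x ≡ - y
  x≡-y = ℤ.i-j≡0⇒i≡j x (- y) (trans (cong (λ z → x + z) (ℤ.neg-involutive y)) x+y≡0)
  ∣y∣≡∣x∣ : ∣ y ∣ ≡ ∣ x ∣
  ∣y∣≡∣x∣ = trans (sym (ℤ.∣-i∣≡∣i∣ y)) (cong ∣_∣ (sym x≡-y))

∥∥²-opposite : (v w : Vec ℤ m) → v ⊕ w ≡ 𝟎 → ∥ w ∥² ≡ ∥ v ∥²
∥∥²-opposite []      []      _  = refl
∥∥²-opposite (x ∷ v) (y ∷ w) eq with ∷-injective eq
... | x+y≡0 , v⊕w≡𝟎 = cong₂ _+_ (x+y≡0⇒y*y≡x*x x y x+y≡0) (∥∥²-opposite v w v⊕w≡𝟎)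

-- A copy of the squared norm in `ℕ`, where each coordinate's square is bounded by the whole without
-- sign conditions.
normℕ : Vec ℤ m → ℕ
normℕ []      = 0
normℕ (x ∷ v) = ∣ x ∣ ℕ.* ∣ x ∣ ℕ.+ normℕ v

∥v∥²≡+normℕ : (v : Vec ℤ m) → ∥ v ∥² ≡ + normℕ v
∥v∥²≡+normℕ []      = refl
∥v∥²≡+normℕ (x ∷ v) = cong₂ _+_ (x*x≡+∣x∣*∣x∣ x) (∥v∥²≡+normℕ v)

interval : ℕ → List ℤ
interval b = map +_ (upTo (suc b)) ++ map -[1+_] (upTo b)

∈-interval : ∀ x → ∣ x ∣ ≤ b → x ∈ interval b
∈-interval         (+ n)    n≤b = ∈-++⁺ˡ (∈-map⁺ +_ (∈-upTo⁺ (s≤s n≤b)))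
∈-interval {b = b} -[1+ n ] n<b = ∈-++⁺ʳ (map +_ (upTo (suc b))) (∈-map⁺ -[1+_] (∈-upTo⁺ n<b))

box : ∀ m → ℕ → List (Vec ℤ m)
box zero    b = [] ∷ []
box (suc m) b = cartesianProductWith _∷_ (interval b) (box m b)

-- A coordinate exceeding `b` in absolute value would alone contribute at least `(b + 1)²`.
∈-box : (v : Vec ℤ m) → normℕ v < suc b ℕ.* suc b → v ∈ box m b
∈-box []      _ = here refl
∈-box {b = b} (x ∷ v) ∥x∷v∥²<1+b² = ∈-cartesianProductWith⁺ _∷_
  (∈-interval {b} x (ℕ.≮⇒≥ λ b<∣x∣ → ℕ.<⇒≱ ∥x∷v∥²<1+b²
    (ℕ.≤-trans (ℕ.*-mono-≤ b<∣x∣ b<∣x∣) (ℕ.m≤m+n _ (normℕ v)))))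
  (∈-box v (ℕ.≤-<-trans (ℕ.m≤n+m (normℕ v) (∣ x ∣ ℕ.* ∣ x ∣)) ∥x∷v∥²<1+b²))

-- Either the head is taken and stays available, or it is dropped for good; choices thus follow the
-- list order, and each multiset arises once.
multisetSums : ℕ → List (Vec ℤ m) → List (Vec ℤ m)
multisetSums zero    _        = 𝟎 ∷ []
multisetSums (suc k) []       = []
multisetSums (suc k) (a ∷ as) = map (a ⊕_) (multisetSums k (a ∷ as)) ++ multisetSums (suc k) as

-- Sorted insertion of `a`: when `a` comes after the head `b`, either `s` is `b ⊕ t`, and `a` is
-- inserted into `t` with `b` kept outermost by `⊕-swap`, or `s` is already a sum over the tail.
∈-multisetSums-⊕ : ∀ k {as : List (Vec ℤ m)} {a s} →
                   a ∈ as → s ∈ multisetSums k as → a ⊕ s ∈ multisetSums (suc k) as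
∈-multisetSums-⊕ k       {b ∷ bs} (here refl) s∈ = ∈-++⁺ˡ (∈-map⁺ (b ⊕_) s∈)
-- The empty sum does not depend on the list, so `s∈` serves for `bs` unchanged.
∈-multisetSums-⊕ zero    {b ∷ bs} (there a∈)  s∈ =
  ∈-++⁺ʳ (map (b ⊕_) (𝟎 ∷ [])) (∈-multisetSums-⊕ zero a∈ s∈)
∈-multisetSums-⊕ (suc k) {b ∷ bs} {a} (there a∈) s∈ =
  [ (λ s∈b → let t , t∈ , s≡b⊕t = ∈-map⁻ (b ⊕_) s∈b in
      subst (_∈ multisetSums (suc (suc k)) (b ∷ bs))
        (trans (⊕-swap b a t) (cong (a ⊕_) (sym s≡b⊕t)))
        (∈-++⁺ˡ (∈-map⁺ (b ⊕_) (∈-multisetSums-⊕ k (there a∈) t∈))))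
  , (λ s∈bs → ∈-++⁺ʳ (map (b ⊕_) (multisetSums (suc k) (b ∷ bs)))
      (∈-multisetSums-⊕ (suc k) a∈ s∈bs))
  ]′ (∈-++⁻ (map (b ⊕_) (multisetSums k (b ∷ bs))) s∈)

vectorSum-∈-multisetSums : {as : List (Vec ℤ m)} {vs : Vec (Vec ℤ m) n} →
                           All (_∈ as) vs → vectorSum vs ∈ multisetSums n as
vectorSum-∈-multisetSums []        = here refl
vectorSum-∈-multisetSums (v∈ ∷ vs∈) = ∈-multisetSums-⊕ _ v∈ (vectorSum-∈-multisetSums vs∈)

hasNorm√? : ∀ r (v : Vec ℤ m) → Dec (HasNorm√ r v)
hasNorm√? r v = ∥ v ∥² ≟ + r

sphere : ∀ m → ℕ → ℕ → List (Vec ℤ m)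
sphere m b r = filter (hasNorm√? r) (box m b)

∈-sphere : (v : Vec ℤ m) → r < suc b ℕ.* suc b → HasNorm√ r v → v ∈ sphere m b r
∈-sphere {r = r} v r<1+b² ∥v∥²≡r = ∈-filter⁺ (hasNorm√? r)
  (∈-box v (subst (_< _) (ℤ.+-injective (trans (sym ∥v∥²≡r) (∥v∥²≡+normℕ v))) r<1+b²))
  ∥v∥²≡r

avoids : ∀ m → ℕ → ℕ → ℕ → Bool
avoids m b r n = all (λ s → not (isYes (hasNorm√? r s))) (multisetSums n (sphere m b r))

-- The first vector is the negative of the sum of the other `n`, so that sum would have squared norm
-- `r`.
avoids⇒¬ZeroSum : r < suc b ℕ.* suc b → avoids m b r n ≡ true → ¬ ZeroSum m r (suc n)
avoids⇒¬ZeroSum {r = r} r<1+b² avoided (v ∷ vs , ∥v∥²≡r ∷ ∥vs∥²≡r , v⊕∑vs≡𝟎) =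
  toWitnessFalse
    (List-All.lookup (all⁺ _ _ (Equivalence.from T-≡ avoided))
      (vectorSum-∈-multisetSums (All.map (λ {w} → ∈-sphere w r<1+b²) ∥vs∥²≡r)))
    (trans (∥∥²-opposite v (vectorSum vs) v⊕∑vs≡𝟎) ∥v∥²≡r)

-- The vectors come from the two decompositions 82 = 81 + 1 + 0 = 64 + 9 + 9.
zeroSum₇ : ZeroSum 3 82 7
zeroSum₇ =
    (- + 9 ∷ - + 1 ∷ + 0   ∷ []) ∷
    (- + 9 ∷ - + 1 ∷ + 0   ∷ []) ∷
    (- + 8 ∷ - + 3 ∷ - + 3 ∷ []) ∷
    (+ 1   ∷ + 0   ∷ + 9   ∷ []) ∷
    (+ 8   ∷ + 3   ∷ - + 3 ∷ []) ∷
    (+ 8   ∷ + 3   ∷ - + 3 ∷ []) ∷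
    (+ 9   ∷ - + 1 ∷ + 0   ∷ []) ∷ []
  , refl ∷ refl ∷ refl ∷ refl ∷ refl ∷ refl ∷ refl ∷ []
  , refl

82<10² : 82 < 10 ℕ.* 10
-- Unfolded, this is 83 ≤ 83 + 17.
82<10² = ℕ.m≤m+n 83 17

7≤n : ∀ n → OddZeroSum 3 82 n → 7 ≤ n
7≤n 0 (() , _)
-- Here and for 3 and 5, `refl` evaluates the test, on 1, 1176 and 249900 sums respectively; even
-- lengths fail by parity.
7≤n 1 (_ , zs) = contradiction zs (avoids⇒¬ZeroSum {b = 9} 82<10² refl)
7≤n 2 (() , _)
7≤n 3 (_ , zs) = contradiction zs (avoids⇒¬ZeroSum {b = 9} 82<10² refl)
7≤n 4 (() , _)
7≤n 5 (_ , zs) = contradiction zs (avoids⇒¬ZeroSum {b = 9} 82<10² refl)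
7≤n 6 (() , _)
7≤n (suc (suc (suc (suc (suc (suc (suc n))))))) _ = ℕ.m≤m+n 7 n

theorem5 : C 3 , 82 ≔ 7
theorem5 = inj₁ ((refl , zeroSum₇) , 7≤n)
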